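{- For $n$ odd, the cycle $C_n$ on $n$ vertices satisfies \[ \overline{\mathrm{scs}}(C_n)=n-2. \]
   Context: $[k]=\{1,\dots,k\}$ and $\chi(G)$ is the chromatic number of a graph $G=(V,E)$. For a proper vertex coloring $c:V\to[\chi(G)]$, a determining set for $(G,c)$ is a set $S\subseteq V$ such that for every proper vertex coloring $c':V\to[\chi(G)]$ of $G$, if $c'|_S=c|_S$ then $c'=c$ on all of $V$. A critical set for $(G,c)$ is a determining set for $(G,c)$ that is minimal under inclusion. Define $\mathrm{scs}(G,c)=\min\{|X| : X \text{ is a critical set for } (G,c)\}$ and $\overline{\mathrm{scs}}(G)=\max_c \mathrm{scs}(G,c)$, where the maximum is over all proper colorings $c:V\to[\chi(G)]$.
   Formalization: The case n = 3 is excluded, because there the claimed formula fails: C_3 is the complete graph K_3, every critical set has two vertices, and the maximum is 2 rather than n − 2 = 1. -}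

module Defs where

open import Level using (0ℓ)
open import Data.Nat using (ℕ; suc; _≤_; s≤s; _≟_)
open import Data.Nat.Properties using (1+n≢n)
open import Data.Fin using (Fin; toℕ)
open import Data.Fin.Subset using (Subset; _∈_; _⊆_; ∣_∣)
open import Data.Product using (∃-syntax; _×_; _,_)
open import Data.Sum using (_⊎_; inj₁; inj₂; swap; [_,_])
open import Relation.Binary using (Rel; Symmetric; Irreflexive; Decidable)
open import Relation.Binary.PropositionalEquality using (_≡_; _≢_; refl)
open import Relation.Nullary using (¬_)
open import Relation.Nullary.Decidable using (_⊎-dec_; _×-dec_)
open import Relation.Unary using (Pred)

IsMinimum : Pred ℕ 0ℓ → Pred ℕ 0ℓ
IsMinimum P m = P m × (∀ k → P k → m ≤ k)

IsMaximum : Pred ℕ 0ℓ → Pred ℕ 0ℓ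
IsMaximum P m = P m × (∀ k → P k → k ≤ m)

record Graph (n : ℕ) : Set₁ where
  field
    Adj    : Rel (Fin n) 0ℓ
    adj?   : Decidable Adj
    symm   : Symmetric Adj
    irrefl : Irreflexive _≡_ Adj

open Graph public

record Coloring {n : ℕ} (G : Graph n) (k : ℕ) : Set where
  field
    color  : Fin n → Fin k
    proper : ∀ {u v} → Adj G u v → color u ≢ color v

open Coloring public

IsChromaticNumber : ∀ {n} → Graph n → Pred ℕ 0ℓ
IsChromaticNumber G = IsMinimum (Coloring G)

module _ {n k : ℕ} {G : Graph n} (c : Coloring G k) where

  Determining : Subset n → Set
  Determining S = ∀ (c′ : Coloring G k) →
    (∀ v → v ∈ S → color c′ v ≡ color c v) →
    ∀ v → color c′ v ≡ color c v

  Critical : Subset n → Set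
  Critical S = Determining S × (∀ T → T ⊆ S → Determining T → T ≡ S)

  IsScs : Pred ℕ 0ℓ
  IsScs = IsMinimum (λ s → ∃[ X ] Critical X × ∣ X ∣ ≡ s)

-- χ, scs and the maximum of scs are given by their graphs as relations:
-- IsMaxScs G m says that the maximum of scs(G,c) over all proper colorings
-- c : V → [χ(G)] is m.
IsMaxScs : ∀ {n} → Graph n → Pred ℕ 0ℓ
IsMaxScs G m = ∃[ χ ] IsChromaticNumber G χ
  × IsMaximum (λ s → ∃[ c ] IsScs {k = χ} {G = G} c s) m

Next : ∀ {n} → Rel (Fin n) 0ℓ
Next {n} i j = suc (toℕ i) ≡ toℕ j ⊎ (suc (toℕ i) ≡ n × toℕ j ≡ 0)

next? : ∀ {n} → Decidable (Next {n})
next? {n} i j = (suc (toℕ i) ≟ toℕ j) ⊎-dec ((suc (toℕ i) ≟ n) ×-dec (toℕ j ≟ 0))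

next-irrefl : ∀ {n} → 3 ≤ n → (i : Fin n) → ¬ Next i i
next-irrefl _ i (inj₁ eq) = 1+n≢n eq
next-irrefl (s≤s (s≤s _)) i (inj₂ (eq , i≡0)) with toℕ i
next-irrefl (s≤s (s≤s _)) i (inj₂ (() , refl)) | .0

cycle : ∀ n → 3 ≤ n → Graph n
cycle n 3≤n = record
  { Adj    = λ i j → Next i j ⊎ Next j i
  ; adj?   = λ i j → next? i j ⊎-dec next? j i
  ; symm   = swap
  ; irrefl = λ { {i} refl → [ next-irrefl 3≤n i , next-irrefl 3≤n i ] }
  }

{-# OPTIONS --safe #-}

-- Call a vertex rainbow if its two neighbours have different colours.  A vertex
-- is forced by its neighbours exactly when it is rainbow, so the complement of
-- two nonadjacent rainbow vertices is determining.  On an odd cycle, walking in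
-- steps of two from a+1 ends at a, whose colour differs, so some vertex
-- at an odd distance at most n-2 after a+1 is rainbow; applying this at most three
-- times yields two nonadjacent rainbow vertices in every colouring.
-- In the colouring 2,1,0,1,0,…,1,0 only vertex 0 and its two neighbours are
-- rainbow, and vertex 0 may be exchanged with either neighbour; so a determining
-- set misses at most vertex 0 alone or the two neighbours of 0.

module Submission where

open import Defs
open import Data.Bool using (if_then_else_)
open import Data.Fin using (Fin; zero; suc; toℕ; fromℕ<)
import Data.Fin.Properties as Fin
open import Data.Fin.Properties using (toℕ-injective; toℕ-fromℕ<; toℕ<n; injective⇒≤)
open import Data.Fin.Subset using (Subset; inside; outside; ⊤; ⁅_⁆; _∈_; _∉_; _⊆_; ∣_∣; _∪_; _-_)
open import Data.Fin.Subset.Properties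
open import Data.Nat using (ℕ; zero; suc; _+_; _*_; _∸_; _≤_; _<_; _≟_; _≤?_; z≤n; s≤s; NonZero)
open import Data.Nat.Divisibility using (_∣_; divides; >⇒∤; ∣m+n∣m⇒∣n; n∣m*n)
open import Data.Nat.DivMod
open import Data.Nat.Induction using (<-wellFounded)
open import Data.Nat.Properties
open import Data.Product using (∃-syntax; _×_; _,_)
open import Data.Sum using (_⊎_; inj₁; inj₂)
open import Data.Vec using ([]; _∷_)
open import Function using (_∘_)
open import Induction.WellFounded using (Acc; acc)
open import Level using (0ℓ)
open import Relation.Binary.PropositionalEquality
open import Relation.Nullary using (¬_; yes; no; does; contradiction)
open import Relation.Nullary.Decidable using (_⊎-dec_; decidable-stable)
open import Relation.Unary using (Pred; Decidable)

-- Cardinalities of subsets missing at most two points.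

∣p∪⁅x⁆∣≤1+∣p∣ : ∀ {n} (p : Subset n) x → ∣ p ∪ ⁅ x ⁆ ∣ ≤ suc ∣ p ∣
∣p∪⁅x⁆∣≤1+∣p∣ (inside  ∷ p) zero    rewrite ∪-identityʳ p = n≤1+n _
∣p∪⁅x⁆∣≤1+∣p∣ (outside ∷ p) zero    rewrite ∪-identityʳ p = ≤-refl
∣p∪⁅x⁆∣≤1+∣p∣ (inside  ∷ p) (suc x) = s≤s (∣p∪⁅x⁆∣≤1+∣p∣ p x)
∣p∪⁅x⁆∣≤1+∣p∣ (outside ∷ p) (suc x) = ∣p∪⁅x⁆∣≤1+∣p∣ p x

-- `x` and `y` may coincide, so a set that misses a single point is covered as well.
n∸2≤∣p∣ : ∀ {n} (p : Subset n) x y → (∀ v → v ≢ x → v ≢ y → v ∈ p) → n ∸ 2 ≤ ∣ p ∣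
n∸2≤∣p∣ {n} p x y covers = m≤n+o⇒m∸n≤o n 2 (begin
  n                         ≡⟨ ∣⊤∣≡n n ⟨
  ∣ ⊤ {n} ∣                 ≤⟨ p⊆q⇒∣p∣≤∣q∣ {p = ⊤} (λ {v} _ → in-cover v) ⟩
  ∣ (p ∪ ⁅ x ⁆) ∪ ⁅ y ⁆ ∣   ≤⟨ ∣p∪⁅x⁆∣≤1+∣p∣ (p ∪ ⁅ x ⁆) y ⟩
  suc ∣ p ∪ ⁅ x ⁆ ∣         ≤⟨ s≤s (∣p∪⁅x⁆∣≤1+∣p∣ p x) ⟩
  2 + ∣ p ∣                 ∎)
  where
  open ≤-Reasoning
  in-cover : ∀ v → v ∈ (p ∪ ⁅ x ⁆) ∪ ⁅ y ⁆
  in-cover v with v Fin.≟ x | v Fin.≟ y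
  ... | yes refl | _        = x∈p∪q⁺ (inj₁ (x∈p∪q⁺ (inj₂ (x∈⁅x⁆ v))))
  ... | no _     | yes refl = x∈p∪q⁺ (inj₂ (x∈⁅x⁆ v))
  ... | no v≢x   | no v≢y   = x∈p∪q⁺ (inj₁ (x∈p∪q⁺ (inj₁ (covers v v≢x v≢y))))

∣⊤-x-y∣≤n∸2 : ∀ {n} {x y : Fin n} → x ≢ y → ∣ ⊤ - x - y ∣ ≤ n ∸ 2
∣⊤-x-y∣≤n∸2 {n} {x} {y} x≢y = m+n≤o⇒m≤o∸n _ (begin
  ∣ ⊤ - x - y ∣ + 2         ≡⟨ +-comm _ 2 ⟩
  2 + ∣ ⊤ - x - y ∣         ≤⟨ s≤s (x∈p⇒∣p-x∣<∣p∣ (x∈p∧x≢y⇒x∈p-y ∈⊤ (x≢y ∘ sym))) ⟩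
  suc ∣ ⊤ - x ∣             ≤⟨ x∈p⇒∣p-x∣<∣p∣ {x = x} ∈⊤ ⟩
  ∣ ⊤ {n} ∣                 ≡⟨ ∣⊤∣≡n n ⟩
  n                         ∎)
  where open ≤-Reasoning

p⊆q∧∣q∣≤∣p∣⇒p≡q : ∀ {n} {p q : Subset n} → p ⊆ q → ∣ q ∣ ≤ ∣ p ∣ → p ≡ q
p⊆q∧∣q∣≤∣p∣⇒p≡q {p = p} p⊆q ∣q∣≤∣p∣ = ⊆-antisym p⊆q λ {x} x∈q →
  decidable-stable (x ∈? p) λ x∉p → <⇒≱ (p⊂q⇒∣p∣<∣q∣ (p⊆q , x , x∈q , x∉p)) ∣q∣≤∣p∣

-- Counting colours.

distinct⇒3≤k : ∀ {k} {a b c : Fin k} → a ≢ b → a ≢ c → b ≢ c → 3 ≤ k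
distinct⇒3≤k {k} {a} {b} {c} a≢b a≢c b≢c = injective⇒≤ {f = f} (λ {x} {y} → inj x y)
  where
  f : Fin 3 → Fin k
  f zero             = a
  f (suc zero)       = b
  f (suc (suc zero)) = c
  inj : ∀ x y → f x ≡ f y → x ≡ y
  inj zero             zero             _  = refl
  inj zero             (suc zero)       eq = contradiction eq a≢b
  inj zero             (suc (suc zero)) eq = contradiction eq a≢c
  inj (suc zero)       zero             eq = contradiction (sym eq) a≢b
  inj (suc zero)       (suc zero)       _  = refl
  inj (suc zero)       (suc (suc zero)) eq = contradiction eq b≢c
  inj (suc (suc zero)) zero             eq = contradiction (sym eq) a≢c
  inj (suc (suc zero)) (suc zero)       eq = contradiction (sym eq) b≢c
  inj (suc (suc zero)) (suc (suc zero)) _  = refl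

-- Punching out `x` leaves three distinct colours, the images of `a`, `b` and `y`, in a palette
-- smaller by one.
distinct₄⇒4≤k : ∀ {k} {a b x y : Fin k} →
  a ≢ b → x ≢ a → x ≢ b → y ≢ a → y ≢ b → x ≢ y → 4 ≤ k
distinct₄⇒4≤k {suc k} {a} {b} {x} {y} a≢b x≢a x≢b y≢a y≢b x≢y =
  s≤s (distinct⇒3≤k (λ eq → a≢b (Fin.punchOut-injective x≢a x≢b eq))
                    (λ eq → y≢a (sym (Fin.punchOut-injective x≢a x≢y eq)))
                    (λ eq → y≢b (sym (Fin.punchOut-injective x≢b x≢y eq))))

third-unique : ∀ {a b x y : Fin 3} → a ≢ b → x ≢ a → x ≢ b → y ≢ a → y ≢ b → x ≡ y
third-unique {x = x} {y} a≢b x≢a x≢b y≢a y≢b = decidable-stable (x Fin.≟ y) λ x≢y →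
  1+n≰n (distinct₄⇒4≤k a≢b x≢a x≢b y≢a y≢b x≢y)

-- Rainbow vertices and determining sets in an arbitrary graph.

module _ {n} {G : Graph n} where

  Rainbow : ∀ {k} → Coloring G k → Fin n → Set
  Rainbow c v = ∃[ u ] ∃[ w ] Adj G u v × Adj G w v × color c u ≢ color c w

  rainbow⇒3≤k : ∀ {k} (c : Coloring G k) {v} → Rainbow c v → 3 ≤ k
  rainbow⇒3≤k c (_ , _ , u~v , w~v , cu≢cw) = distinct⇒3≤k cu≢cw (proper c u~v) (proper c w~v)

  nonadjacent-rainbows⇒determining : (c : Coloring G 3) {g h : Fin n} → ¬ Adj G g h →
    Rainbow c g → Rainbow c h → Determining c (⊤ - g - h)
  nonadjacent-rainbows⇒determining c {g} {h} g≁h rg rh c′ agree = forced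
    where
    agrees : ∀ v → v ≢ g → v ≢ h → color c′ v ≡ color c v
    agrees v v≢g v≢h = agree v (x∈p∧x≢y⇒x∈p-y (x∈p∧x≢y⇒x∈p-y ∈⊤ v≢g) v≢h)

    -- Two neighbours on which the colourings agree exclude two of the three colours, so both
    -- colourings have the remaining one at `v`.
    rainbow-forced : ∀ {v} → Rainbow c v → (∀ {u} → Adj G u v → color c′ u ≡ color c u) →
      color c′ v ≡ color c v
    rainbow-forced (_ , _ , u~v , w~v , cu≢cw) nbr = third-unique cu≢cw
      (λ eq → proper c′ u~v (trans (nbr u~v) (sym eq)))
      (λ eq → proper c′ w~v (trans (nbr w~v) (sym eq)))
      (proper c u~v ∘ sym) (proper c w~v ∘ sym)

    forced : ∀ v → color c′ v ≡ color c v
    forced v with v Fin.≟ g | v Fin.≟ h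
    ... | yes refl | _ = rainbow-forced rg λ {u} u~g →
      agrees u (λ u≡g → irrefl G u≡g u~g) (λ { refl → g≁h (symm G u~g) })
    ... | no _ | yes refl = rainbow-forced rh λ {u} u~h →
      agrees u (λ { refl → g≁h u~h }) (λ u≡h → irrefl G u≡h u~h)
    ... | no v≢g | no v≢h = agrees v v≢g v≢h

  -- A critical subset of `S` is not searched for, since `Determining` is not decided. Instead, if
  -- the bound failed for `S`, the induction on size would rule out smaller determining subsets, and
  -- `S` itself would be critical.
  scs≤determining : ∀ {k s} {c : Coloring G k} → IsScs c s → ∀ S → Determining c S → s ≤ ∣ S ∣
  scs≤determining {s = s} {c} (_ , least) S = go S (<-wellFounded ∣ S ∣)
    where
    go : ∀ S → Acc _<_ ∣ S ∣ → Determining c S → s ≤ ∣ S ∣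
    go S (acc smaller) det = decidable-stable (s ≤? ∣ S ∣) λ s≰∣S∣ →
      s≰∣S∣ (least ∣ S ∣ (S , (det , λ T T⊆S detT →
        p⊆q∧∣q∣≤∣p∣⇒p≡q T⊆S (≮⇒≥ λ ∣T∣<∣S∣ →
          s≰∣S∣ (≤-trans (go T (smaller ∣T∣<∣S∣) detT) (<⇒≤ ∣T∣<∣S∣)))) , refl))

-- Walking around the cycle.

module Walk {n} (3≤n : 3 ≤ n) .{{_ : NonZero n}} where

  walk : ℕ → Fin n
  walk i = i mod n

  toℕ-walk : ∀ i → toℕ (walk i) ≡ i % n
  toℕ-walk i = toℕ-fromℕ< (m%n<n i n)

  walk-periodic : ∀ i → walk (i + n) ≡ walk i
  walk-periodic i = toℕ-injective (begin
    toℕ (walk (i + n)) ≡⟨ toℕ-walk (i + n) ⟩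
    (i + n) % n        ≡⟨ [m+n]%n≡m%n i n ⟩
    i % n              ≡⟨ toℕ-walk i ⟨
    toℕ (walk i)       ∎)
    where open ≡-Reasoning

  suc-% : ∀ i → suc i % n ≡ suc (i % n) % n
  suc-% i = trans (cong (λ j → suc j % n) (m≡m%n+[m/n]*n i n)) ([m+kn]%n≡m%n (suc (i % n)) (i / n) n)

  next-walk : ∀ i → Next (walk i) (walk (suc i))
  next-walk i rewrite toℕ-walk i | toℕ-walk (suc i) | suc-% i with suc (i % n) ≟ n
  ... | yes 1+r≡n = inj₂ (1+r≡n , trans (cong (_% n) 1+r≡n) (n%n≡0 n))
  ... | no  1+r≢n = inj₁ (sym (m<n⇒m%n≡m (≤∧≢⇒< (m%n<n i n) 1+r≢n)))

  next-functional : {u v w : Fin n} → Next u v → Next u w → v ≡ w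
  next-functional (inj₁ p) (inj₁ q) = toℕ-injective (trans (sym p) q)
  next-functional {v = v} (inj₁ p) (inj₂ (q , _)) = contradiction (trans (sym p) q) (<⇒≢ (toℕ<n v))
  next-functional {w = w} (inj₂ (q , _)) (inj₁ p) = contradiction (trans (sym p) q) (<⇒≢ (toℕ<n w))
  next-functional (inj₂ (_ , p)) (inj₂ (_ , q)) = toℕ-injective (trans p (sym q))

  -- Cancelling the common remainder of `i` and `d + i` leaves `d` as a difference of two multiples
  -- of `n`.
  walk-injective : ∀ i d → walk i ≡ walk (d + i) → n ∣ d
  walk-injective i d eq = ∣m+n∣m⇒∣n (subst (n ∣_) (sym multiples) (n∣m*n ((d + i) / n))) (n∣m*n (i / n))
    where
    open ≡-Reasoning
    same-% : i % n ≡ (d + i) % n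
    same-% = trans (sym (toℕ-walk i)) (trans (cong toℕ eq) (toℕ-walk (d + i)))
    multiples : i / n * n + d ≡ (d + i) / n * n
    multiples = +-cancelˡ-≡ (i % n) _ _ (begin
      i % n + (i / n * n + d)         ≡⟨ +-assoc (i % n) _ d ⟨
      (i % n + i / n * n) + d         ≡⟨ cong (_+ d) (m≡m%n+[m/n]*n i n) ⟨
      i + d                           ≡⟨ +-comm i d ⟩
      d + i                           ≡⟨ m≡m%n+[m/n]*n (d + i) n ⟩
      (d + i) % n + (d + i) / n * n   ≡⟨ cong (_+ (d + i) / n * n) same-% ⟨
      i % n + (d + i) / n * n         ∎)

  walk-distinct : ∀ i d → 0 < d → d < n → walk i ≢ walk (d + i)
  walk-distinct i (suc d) _ d<n eq = >⇒∤ d<n (walk-injective i (suc d) eq)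

  -- Adjacency would close the walk after `d - 1` or `d + 1` steps, and both numbers lie strictly
  -- between 0 and `n`.
  walk-nonadjacent : ∀ i d → 2 ≤ d → d + 2 ≤ n → ¬ Adj (cycle n 3≤n) (walk i) (walk (d + i))
  walk-nonadjacent i (suc d) (s≤s 1≤d) d+2≤n (inj₁ next) =
    walk-distinct (suc i) d 1≤d (≤-trans (m≤m+n _ 2) d+2≤n)
      (trans (next-functional (next-walk i) next) (cong walk (sym (+-suc d i))))
  walk-nonadjacent i d 2≤d d+2≤n (inj₂ next) =
    walk-distinct i (suc d) (s≤s z≤n) (subst (_≤ n) (+-comm d 2) d+2≤n)
      (next-functional next (next-walk (d + i)))

  -- Rainbow vertices along the walk.

  module _ {k} (c : Coloring (cycle n 3≤n) k) where

    -- Indexed by the position before the rainbow vertex, which is `walk (suc i)`.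
    Turn : ℕ → Set
    Turn i = color c (walk i) ≢ color c (walk (2 + i))

    turn⇒rainbow : ∀ {i} → Turn i → Rainbow c (walk (suc i))
    turn⇒rainbow {i} turn = walk i , walk (2 + i) , inj₁ (next-walk i) , inj₂ (next-walk (suc i)) , turn

    turn-or-equal : ∀ a m → (∃[ j ] j < m × Turn (j * 2 + a)) ⊎
      color c (walk a) ≡ color c (walk (m * 2 + a))
    turn-or-equal a zero = inj₂ refl
    turn-or-equal a (suc m) with turn-or-equal a m
    ... | inj₁ (j , j<m , turn) = inj₁ (j , m<n⇒m<1+n j<m , turn)
    ... | inj₂ eq with color c (walk (m * 2 + a)) Fin.≟ color c (walk (2 + (m * 2 + a)))
    ...   | yes eq′ = inj₂ (trans eq eq′)
    ...   | no  turn = inj₁ (m , ≤-refl , turn)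

    module _ m (n≡1+2m : n ≡ suc (m * 2)) where

      turn-after : ∀ a → ∃[ j ] j < m × Turn (suc (j * 2) + a)
      turn-after a with turn-or-equal (suc a) m
      ... | inj₁ (j , j<m , turn) = j , j<m , subst Turn (+-suc (j * 2) a) turn
      ... | inj₂ eq = contradiction (sym (trans eq (cong (color c) closes))) (proper c (inj₁ (next-walk a)))
        where
        open ≡-Reasoning
        -- `m` double steps from `suc a` end `n` steps after `a`, hence at `a` again.
        closes : walk (m * 2 + suc a) ≡ walk a
        closes = begin
          walk (m * 2 + suc a)   ≡⟨ cong walk (+-suc (m * 2) a) ⟩
          walk (suc (m * 2) + a) ≡⟨ cong (λ l → walk (l + a)) n≡1+2m ⟨
          walk (n + a)           ≡⟨ cong walk (+-comm n a) ⟩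
          walk (a + n)           ≡⟨ walk-periodic a ⟩
          walk a                 ∎

      -- If turns after i and i+1 only come one step later, then i, i+1 and i+2 are
      -- all turns; otherwise the distance found is odd, at least 3 and at most n-2.
      separated-turns : 2 ≤ m → ∃[ i ] ∃[ d ] 2 ≤ d × d + 2 ≤ n × Turn i × Turn (d + i)
      separated-turns 2≤m with turn-after 0
      ... | j₀ , _ , turn₀ = from (suc (j₀ * 2) + 0) turn₀
        where
        far : ∀ {j} → suc j < m → suc (suc j * 2) + 2 ≤ n
        far {j} 1+j<m = subst₂ _≤_ (+-comm 2 (suc (suc j * 2))) (sym n≡1+2m) (s≤s (*-monoˡ-≤ 2 1+j<m))
        -- Vertices two steps apart are nonadjacent only from `n = 4` on; this is where `2 ≤ m`
        -- enters.
        4≤n : 4 ≤ n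
        4≤n = subst (4 ≤_) (sym n≡1+2m) (m≤n⇒m≤1+n (*-monoˡ-≤ 2 2≤m))
        from : ∀ i → Turn i → ∃[ i ] ∃[ d ] 2 ≤ d × d + 2 ≤ n × Turn i × Turn (d + i)
        from i turn with turn-after i
        ... | suc j , 1+j<m , turn′ = i , suc (suc j * 2) , s≤s (s≤s z≤n) , far 1+j<m , turn , turn′
        ... | zero , _ , turn₁ with turn-after (suc i)
        ...   | suc j , 1+j<m , turn₂ = suc i , suc (suc j * 2) , s≤s (s≤s z≤n) , far 1+j<m , turn₁ , turn₂
        ...   | zero , _ , turn₂ = i , 2 , s≤s (s≤s z≤n) , 4≤n , turn , turn₂

  ∃-small-determining : ∀ m → n ≡ suc (m * 2) → 2 ≤ m → (c : Coloring (cycle n 3≤n) 3) →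
    ∃[ S ] Determining c S × ∣ S ∣ ≤ n ∸ 2
  ∃-small-determining m n≡1+2m 2≤m c with separated-turns c m n≡1+2m 2≤m
  ... | i , d , 2≤d , d+2≤n , turn , turn′ =
    _ , nonadjacent-rainbows⇒determining c g≁h (turn⇒rainbow c turn) (turn⇒rainbow c turn′)
      , ∣⊤-x-y∣≤n∸2 g≢h
    where
    h≡ : walk (d + suc i) ≡ walk (suc (d + i))
    h≡ = cong walk (+-suc d i)
    g≁h : ¬ Adj (cycle n 3≤n) (walk (suc i)) (walk (suc (d + i)))
    g≁h = subst (¬_ ∘ Adj (cycle n 3≤n) _) h≡ (walk-nonadjacent (suc i) d 2≤d d+2≤n)
    g≢h : walk (suc i) ≢ walk (suc (d + i))
    g≢h eq = walk-distinct (suc i) d (<⇒≤ 2≤d)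
      (≤-trans (n≤1+n _) (subst (_≤ n) (+-comm d 2) d+2≤n)) (trans eq (sym h≡))

-- Colour sequences.

pattern two = suc (suc zero)

alternate : ℕ → Fin 3
alternate zero          = zero
alternate (suc zero)    = suc zero
alternate (suc (suc i)) = alternate i

alternate-proper : ∀ i → alternate i ≢ alternate (suc i)
alternate-proper zero          ()
alternate-proper (suc zero)    ()
alternate-proper (suc (suc i)) = alternate-proper i

alternate≢two : ∀ i → alternate i ≢ two
alternate≢two zero          ()
alternate≢two (suc zero)    ()
alternate≢two (suc (suc i)) = alternate≢two i

alternate-even : ∀ m → alternate (m * 2) ≡ zero
alternate-even zero    = refl
alternate-even (suc m) = alternate-even m

module _ {P : Pred ℕ 0ℓ} (P? : Decidable P) where

  -- The extremal colouring and all but one of the recolourings compared with it arise from suitable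
  -- choices of `P`.
  mark : ℕ → Fin 3
  mark i = if does (P? i) then two else alternate i

  mark-∈ : ∀ {i} → P i → mark i ≡ two
  mark-∈ {i} Pi with P? i
  ... | yes _  = refl
  ... | no ¬Pi = contradiction Pi ¬Pi

  mark-∉ : ∀ {i} → ¬ P i → mark i ≡ alternate i
  mark-∉ {i} ¬Pi with P? i
  ... | yes Pi = contradiction Pi ¬Pi
  ... | no _   = refl

  mark-proper : ∀ i → ¬ (P i × P (suc i)) → mark i ≢ mark (suc i)
  mark-proper i ¬both with P? i | P? (suc i)
  ... | yes p | yes q = contradiction (p , q) ¬both
  ... | yes _ | no _  = alternate≢two (suc i) ∘ sym
  ... | no _  | yes _ = alternate≢two i
  ... | no _  | no _  = alternate-proper i

-- The colouring that exchanges the colours of vertices 0 and 1 of the extremal one.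
swapped : ℕ → Fin 3
swapped zero          = suc zero
swapped (suc zero)    = two
swapped (suc (suc i)) = alternate i

swapped-proper : ∀ i → swapped i ≢ swapped (suc i)
swapped-proper zero          ()
swapped-proper (suc zero)    ()
swapped-proper (suc (suc i)) = alternate-proper i

-- Determining sets of the extremal colouring.

module Extremal {n} (3≤n : 3 ≤ n) where

  fromSequence : ∀ {k} (f : ℕ → Fin k) → (∀ i → suc i < n → f i ≢ f (suc i)) →
    (∀ i → suc i ≡ n → f i ≢ f 0) → Coloring (cycle n 3≤n) k
  fromSequence f step close = record
    { color  = f ∘ toℕ
    ; proper = λ { (inj₁ next) → proper-next next ; (inj₂ next) → proper-next next ∘ sym }
    }
    where
    proper-next : ∀ {u v} → Next u v → f (toℕ u) ≢ f (toℕ v)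
    proper-next {u} {v} (inj₁ eq) eq′ =
      step (toℕ u) (subst (_< n) (sym eq) (toℕ<n v)) (trans eq′ (cong f (sym eq)))
    proper-next {u} {v} (inj₂ (last , first)) eq′ = close (toℕ u) last (trans eq′ (cong f first))

  -- Exactly one of vertex 0 and the last vertex gets colour `two`, so the closing edge is proper
  -- for either parity of `n`.
  marked : ∀ {P : Pred ℕ 0ℓ} → Decidable P → (∀ i → ¬ (P i × P (suc i))) →
    (∀ i → suc i ≡ n → (P i × ¬ P 0) ⊎ (¬ P i × P 0)) → Coloring (cycle n 3≤n) 3
  marked {P} P? sparse ends = fromSequence (mark P?) (λ i _ → mark-proper P? i (sparse i)) close
    where
    close : ∀ i → suc i ≡ n → mark P? i ≢ mark P? 0
    close i last eq with ends i last
    ... | inj₁ (Pi , ¬P0) with () ← trans (sym (mark-∈ P? Pi)) (trans eq (mark-∉ P? ¬P0))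
    ... | inj₂ (¬Pi , P0) = alternate≢two i (trans (sym (mark-∉ P? ¬Pi)) (trans eq (mark-∈ P? P0)))

  last≢0 : ∀ {i} → suc i ≡ n → i ≢ 0
  last≢0 last refl = contradiction (subst (3 ≤_) (sym last) 3≤n) λ { (s≤s ()) }

  extremal : Coloring (cycle n 3≤n) 3
  extremal = marked (_≟ 0) (λ { _ (_ , ()) }) (λ _ last → inj₂ (last≢0 last , refl))

  origin : Fin n
  origin = fromℕ< (<⇒≤ (<⇒≤ 3≤n))

  toℕ-origin : toℕ origin ≡ 0
  toℕ-origin = toℕ-fromℕ< (<⇒≤ (<⇒≤ 3≤n))

  toℕ≡0⇒origin : ∀ {v} → toℕ v ≡ 0 → v ≡ origin
  toℕ≡0⇒origin eq = toℕ-injective (trans eq (sym toℕ-origin))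

  module _ {X : Subset n} (det : Determining extremal X) where

    -- Neither neighbour of `v` is vertex 0, the only vertex coloured `two`. So `v` alone could be
    -- recoloured with `two` if it were outside `X`.
    interior∈ : ∀ v → 2 ≤ toℕ v → suc (toℕ v) < n → v ∈ X
    interior∈ v 2≤v 1+v<n = decidable-stable (v ∈? X) λ v∉X →
      alternate≢two (toℕ v)
        (trans (sym (mark-∉ (_≟ 0) v≢0))
          (trans (sym (det recoloured (agree v∉X) v)) (mark-∈ P? (inj₂ refl))))
      where
      v≢0 : toℕ v ≢ 0
      v≢0 = ≢-sym (<⇒≢ (<⇒≤ 2≤v))
      P? : Decidable (λ i → i ≡ 0 ⊎ i ≡ toℕ v)
      P? i = (i ≟ 0) ⊎-dec (i ≟ toℕ v)
      recoloured : Coloring (cycle n 3≤n) 3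
      recoloured = marked P?
        (λ { _ (_ , inj₁ ())
           ; _ (inj₁ refl , inj₂ eq) → <⇒≢ 2≤v eq
           ; _ (inj₂ refl , inj₂ eq) → 1+n≢n eq })
        (λ _ last → inj₂ ((λ { (inj₁ eq) → last≢0 last eq ; (inj₂ refl) → <⇒≢ 1+v<n last }) , inj₁ refl))
      agree : v ∉ X → ∀ u → u ∈ X → mark P? (toℕ u) ≡ mark (_≟ 0) (toℕ u)
      agree v∉X u u∈X with toℕ u ≟ 0
      ... | yes u≡0 = trans (mark-∈ P? (inj₁ u≡0)) (sym (mark-∈ (_≟ 0) u≡0))
      ... | no u≢0 = trans
        (mark-∉ P? λ { (inj₁ u≡0) → u≢0 u≡0
                     ; (inj₂ u≡v) → v∉X (subst (_∈ X) (toℕ-injective u≡v) u∈X) })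
        (sym (mark-∉ (_≟ 0) u≢0))

    module _ (0∉X : origin ∉ X) where

      ∈⇒≢0 : ∀ {u} → u ∈ X → toℕ u ≢ 0
      ∈⇒≢0 u∈X u≡0 = 0∉X (subst (_∈ X) (toℕ≡0⇒origin u≡0) u∈X)

      origin-fixed : (c : Coloring (cycle n 3≤n) 3) →
        (∀ u → u ∈ X → color c u ≡ color extremal u) → color c origin ≡ two
      origin-fixed c agree = trans (det c agree origin) (mark-∈ (_≟ 0) toℕ-origin)

      -- Otherwise `two` can be moved from vertex 0 to the last vertex, giving vertex 0 the colour
      -- `zero` and changing nothing on `X`.
      last∈ : ∀ v → suc (toℕ v) ≡ n → v ∈ X
      last∈ v last = decidable-stable (v ∈? X) λ v∉X →
        contradiction
          (trans (sym (trans (mark-∉ P? (subst (λ i → suc i ≢ n) (sym toℕ-origin) 1≢n))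
                             (cong alternate toℕ-origin)))
            (origin-fixed recoloured (agree v∉X)))
          λ ()
        where
        P? : Decidable (λ i → suc i ≡ n)
        P? i = suc i ≟ n
        1≢n : 1 ≢ n
        1≢n eq = last≢0 eq refl
        recoloured : Coloring (cycle n 3≤n) 3
        recoloured = marked P? (λ _ (p , q) → 1+n≢n (trans q (sym p))) (λ _ last → inj₁ (last , 1≢n))
        agree : v ∉ X → ∀ u → u ∈ X → mark P? (toℕ u) ≡ mark (_≟ 0) (toℕ u)
        agree v∉X u u∈X = trans
          (mark-∉ P? λ last′ → v∉X (subst (_∈ X) (toℕ-injective (suc-injective (trans last′ (sym last)))) u∈X))
          (sym (mark-∉ (_≟ 0) (∈⇒≢0 u∈X)))

      -- Moving `two` to vertex 1 by `mark` would give vertex 0 the colour `zero` of the last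
      -- vertex, so `swapped` gives it `suc zero` instead.
      first∈ : ∀ m → n ≡ suc (m * 2) → ∀ v → toℕ v ≡ 1 → v ∈ X
      first∈ m n≡1+2m v v≡1 = decidable-stable (v ∈? X) λ v∉X →
        contradiction
          (trans (sym (cong swapped toℕ-origin)) (origin-fixed recoloured (agree v∉X)))
          λ ()
        where
        close : ∀ i → suc i ≡ n → swapped i ≢ suc zero
        close zero          last _  = last≢0 last refl
        close (suc zero)    last ()
        -- Oddness enters here: the last index is `m * 2`, so the last vertex has colour `zero`.
        close (suc (suc i)) last eq
          with () ← trans (sym eq) (trans (cong alternate (suc-injective (trans last n≡1+2m))) (alternate-even m))
        recoloured : Coloring (cycle n 3≤n) 3
        recoloured = fromSequence swapped (λ i _ → swapped-proper i) close
        swapped≡mark : ∀ i → i ≢ 0 → i ≢ 1 → swapped i ≡ mark (_≟ 0) i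
        swapped≡mark zero          i≢0 _   = contradiction refl i≢0
        swapped≡mark (suc zero)    _   i≢1 = contradiction refl i≢1
        swapped≡mark (suc (suc i)) _   _   = refl
        agree : v ∉ X → ∀ u → u ∈ X → swapped (toℕ u) ≡ mark (_≟ 0) (toℕ u)
        agree v∉X u u∈X = swapped≡mark (toℕ u) (∈⇒≢0 u∈X) λ u≡1 →
          v∉X (subst (_∈ X) (toℕ-injective (trans u≡1 (sym v≡1))) u∈X)

    n∸2≤∣X∣ : ∀ m → n ≡ suc (m * 2) → n ∸ 2 ≤ ∣ X ∣
    n∸2≤∣X∣ m n≡1+2m with origin ∈? X
    -- Only vertex 0 is missed, so it fills both exempt places.
    ... | no 0∉X = n∸2≤∣p∣ X origin origin covers
      where
      covers : ∀ v → v ≢ origin → v ≢ origin → v ∈ X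
      covers v v≢0 _ with toℕ v in eq | suc (toℕ v) ≟ n
      ... | zero        | _        = contradiction (toℕ≡0⇒origin eq) v≢0
      ... | suc zero    | _        = first∈ 0∉X m n≡1+2m v eq
      ... | suc (suc _) | yes last = last∈ 0∉X v (trans (cong suc eq) last)
      ... | suc (suc _) | no ¬last =
        interior∈ v (subst (2 ≤_) (sym eq) (s≤s (s≤s z≤n))) (≤∧≢⇒< (toℕ<n v) (¬last ∘ trans (cong suc (sym eq))))
    ... | yes 0∈X = n∸2≤∣p∣ X (fromℕ< 1<n) (fromℕ< last<n) covers
      where
      1<n : 1 < n
      1<n = <⇒≤ 3≤n
      last<n : n ∸ 1 < n
      last<n = ∸-monoʳ-< {n} {1} {0} (s≤s z≤n) (<⇒≤ 1<n)
      covers : ∀ v → v ≢ fromℕ< 1<n → v ≢ fromℕ< last<n → v ∈ X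
      covers v v≢1 v≢last with toℕ v in eq | suc (toℕ v) ≟ n
      ... | zero        | _        = subst (_∈ X) (sym (toℕ≡0⇒origin eq)) 0∈X
      ... | suc zero    | _        = contradiction (toℕ-injective (trans eq (sym (toℕ-fromℕ< 1<n)))) v≢1
      ... | suc (suc _) | yes last = contradiction
        (toℕ-injective (trans (cong (_∸ 1) (trans (cong suc eq) last)) (sym (toℕ-fromℕ< last<n)))) v≢last
      ... | suc (suc _) | no ¬last =
        interior∈ v (subst (2 ≤_) (sym eq) (s≤s (s≤s z≤n))) (≤∧≢⇒< (toℕ<n v) (¬last ∘ trans (cong suc (sym eq))))

open Walk using (separated-turns; turn⇒rainbow; ∃-small-determining)
open Extremal using (extremal; n∸2≤∣X∣)

-- Parity, the chromatic number and the maximum.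

odd⇒≡1+2m : ∀ n → ¬ (2 ∣ n) → ∃[ m ] n ≡ suc (m * 2)
odd⇒≡1+2m n 2∤n with n % 2 | m≡m%n+[m/n]*n n 2 | m%n<n n 2
... | zero        | eq | _ = contradiction (divides (n / 2) eq) 2∤n
... | suc zero    | eq | _ = n / 2 , eq
... | suc (suc _) | _  | s≤s (s≤s ())

theorem8 : (n : ℕ) (3≤n : 3 ≤ n) → ¬ (2 ∣ n) → n ≢ 3 → IsMaxScs (cycle n 3≤n) (n ∸ 2)
theorem8 n@(suc _) 3≤n 2∤n n≢3 with odd⇒≡1+2m n 2∤n
... | zero , n≡1       = contradiction (subst (3 ≤_) n≡1 3≤n) λ { (s≤s ()) }
-- A triangle has no two distinct nonadjacent vertices; there one coloured vertex leaves the other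
-- two exchangeable.
... | suc zero , n≡3   = contradiction n≡3 n≢3
... | m@(suc (suc _)) , n≡1+2m =
  3 , (c₀ , λ _ → 3≤k) , (c₀ , c₀-scs) , λ s (c , scs) → bound c scs
  where
  c₀ : Coloring (cycle n 3≤n) 3
  c₀ = extremal 3≤n
  2≤m : 2 ≤ m
  2≤m = s≤s (s≤s z≤n)
  -- Any colouring has a rainbow vertex, which together with two neighbours shows three colours.
  3≤k : ∀ {k} → Coloring (cycle n 3≤n) k → 3 ≤ k
  3≤k c with separated-turns 3≤n c m n≡1+2m 2≤m
  ... | _ , _ , _ , _ , turn , _ = rainbow⇒3≤k c (turn⇒rainbow 3≤n c turn)
  bound : (c : Coloring (cycle n 3≤n) 3) → ∀ {s} → IsScs c s → s ≤ n ∸ 2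
  bound c scs with ∃-small-determining 3≤n m n≡1+2m 2≤m c
  ... | S , det , ∣S∣≤n∸2 = ≤-trans (scs≤determining {c = c} scs S det) ∣S∣≤n∸2
  n∸2≤∣det∣ : ∀ {X} → Determining c₀ X → n ∸ 2 ≤ ∣ X ∣
  n∸2≤∣det∣ det = n∸2≤∣X∣ 3≤n det m n≡1+2m
  c₀-scs : IsScs c₀ (n ∸ 2)
  c₀-scs with ∃-small-determining 3≤n m n≡1+2m 2≤m c₀
  ... | S , det , ∣S∣≤n∸2 =
    -- Size alone makes `S` critical: a determining subset `T` has at least `n ∸ 2` elements, and
    -- `S` has no more.
    (S , (det , λ T T⊆S detT → p⊆q∧∣q∣≤∣p∣⇒p≡q T⊆S (≤-trans ∣S∣≤n∸2 (n∸2≤∣det∣ {T} detT)))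
       , ≤-antisym ∣S∣≤n∸2 (n∸2≤∣det∣ det)) ,
    λ { _ (X , (detX , _) , refl) → n∸2≤∣det∣ detX }
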